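{- Let $L$ be a finite distributive lattice, let $B_L$ be the set of its join-irreducible elements, let $\mathbb{S}$ be a set and $R\colon\mathbb{S}\times\mathbb{S}\to L$ a multi-valued transition system over $L$. Let $L^{\mathbb{S}}$ be equipped with the basis $\{b_x\mid x\in\mathbb{S},\,b\in B_L\}$. The following families (indexed by $b\in B_L$, $x\in\mathbb{S}$) are symbolic $\exists$-moves for the corresponding semantic functions: (1) for $\sqcup\colon L^{\mathbb{S}}\times L^{\mathbb{S}}\to L^{\mathbb{S}}$: $\psi^{\sqcup}_{b_x}=[b_x,1]\lor[b_x,2]$; (2) for $\sqcap\colon L^{\mathbb{S}}\times L^{\mathbb{S}}\to L^{\mathbb{S}}$: $\psi^{\sqcap}_{b_x}=[b_x,1]\land[b_x,2]$; (3) for $l\Rightarrow\_\,\colon L^{\mathbb{S}}\to L^{\mathbb{S}}$ (where $l\in L$ is fixed and seen as a constant function $\mathbb{S}\to L$): $\psi^{\Rightarrow}_{b_x}=\bigwedge\{[b'_x,1]\mid b'\in B_L,\ b'\sqsubseteq l,\ b'\sqsubseteq b\}$; (4) for $\Diamond\colon L^{\mathbb{S}}\to L^{\mathbb{S}}$: $\psi^{\Diamond}_{b_x}=\bigvee\{[b_y,1]\mid y\in\mathbb{S},\ b\sqsubseteq R(x,y)\}$; (5) for $\Box\colon L^{\mathbb{S}}\to L^{\mathbb{S}}$: $\psi^{\Box}_{b_x}=\bigwedge\{[b'_y,1]\mid y\in\mathbb{S},\ b'\in B_L,\ b'\sqsubseteq R(x,y),\ b'\sqsubseteq b\}$.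
   Context: An element $b$ of a lattice is (completely) join-irreducible if $b=\bigsqcup X$ implies $b\in X$ (so $\bot$ is not join-irreducible). $L^{\mathbb{S}}$ is the set of functions $\mathbb{S}\to L$ with pointwise order and operations. For $b\in B_L$, $x\in\mathbb{S}$, $b_x\in L^{\mathbb{S}}$ is the function with $b_x(x)=b$ and $b_x(y)=\bot$ for $y\ne x$. Residuation: $(l\Rightarrow m)=\bigsqcup\{l'\in L\mid l\sqcap l'\sqsubseteq m\}$, applied pointwise on $L^{\mathbb{S}}$. Modal operators: for $u\in L^{\mathbb{S}}$, $(\Diamond u)(x)=\bigsqcup_{y\in\mathbb{S}}(R(x,y)\sqcap u(y))$ and $(\Box u)(x)=\inf_{y\in\mathbb{S}}(R(x,y)\Rightarrow u(y))$. Logic: for a lattice $M$ with basis $B_M$ and $n\in\mathbb{N}$, formulae of $\mathcal{L}_n(B_M)$ are $\varphi::=[c,j]\mid\bigvee_{k\in K}\varphi_k\mid\bigwedge_{k\in K}\varphi_k$ with $c\in B_M$, $j\in\{1,\dots,n\}$ ($K$ arbitrary). Semantics: $[\![[c,j]]\!]=\{\boldsymbol{l}\in M^n\mid c\sqsubseteq l_j\}$, disjunction is union, conjunction is intersection (empty conjunction denotes $M^n$). A symbolic $\exists$-move for a monotone function $f\colon M^n\to M$ is a family $(\varphi_c)_{c\in B_M}$ of formulae of $\mathcal{L}_n(B_M)$ with $[\![\varphi_c]\!]=\{\boldsymbol{l}\in M^n\mid c\sqsubseteq f(\boldsymbol{l})\}$ for all $c\in B_M$. Here $M=L^{\mathbb{S}}$.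 -}

module Defs where

open import Axiom.DoubleNegationElimination using (em⇒dne)
open import Axiom.ExcludedMiddle using (ExcludedMiddle)
open import Data.Bool.Base using (Bool; if_then_else_)
open import Data.Fin.Base using (Fin; zero; suc)
import Data.Fin.Induction as FinInd
open import Data.Nat.Base using (ℕ; zero; suc)
open import Data.Product.Base using (Σ; Σ-syntax; ∃-syntax; _×_; _,_; proj₁; proj₂)
open import Data.Vec.Functional using (Vector; foldr; tail)
open import Data.Vec.Functional.Relation.Binary.Pointwise using (Pointwise)
open import Function.Bundles using (Inverse)
open import Induction.WellFounded using (Acc; acc)
open import Level using (Lift; lift; lower; _⊔_) renaming (suc to lsuc)
open import Relation.Binary.Core using (Rel; _Preserves_⟶_)
open import Relation.Binary.Definitions using (Minimum)
open import Relation.Binary.Lattice.Bundles using (Lattice; DistributiveLattice)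
import Relation.Binary.Construct.NonStrictToStrict as ToStrict
import Relation.Binary.Construct.On as On
open import Relation.Binary.PropositionalEquality using (_≡_; refl)
open import Relation.Binary.PropositionalEquality using () renaming (setoid to ≡-setoid)
open import Relation.Nullary using (yes; no; does; contradiction)
open import Relation.Unary using (Pred; _≐_)

module _ {a r} {A : Set a} (_≤_ : Rel A r) where

  IsLub : ∀ {p} → Pred A p → A → Set (a ⊔ r ⊔ p)
  IsLub X s = (∀ {x} → X x → x ≤ s) × (∀ {z} → (∀ {x} → X x → x ≤ z) → s ≤ z)

  IsGlb : ∀ {p} → Pred A p → A → Set (a ⊔ r ⊔ p)
  IsGlb X s = (∀ {x} → X x → s ≤ x) × (∀ {z} → (∀ {x} → X x → z ≤ x) → z ≤ s)

-- Every element is the join of the basis elements below it.  The basis is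
-- presented as the image of a family of elements.
record Basis {c ℓ₁ ℓ₂} (M : Lattice c ℓ₁ ℓ₂) k : Set (c ⊔ ℓ₁ ⊔ ℓ₂ ⊔ lsuc k) where
  open Lattice M
  field
    Index     : Set k
    elem      : Index → Carrier
    generates : ∀ m → IsLub _≤_ (λ m′ → ∃[ c ] (m′ ≈ elem c × m′ ≤ m)) m

-- Positions j ∈ {1,…,n} are rendered as elements of Fin n: position 1
-- is zero and position 2 is suc zero.
data Formula {k} (B : Set k) (n : ℕ) : Set (lsuc k) where
  [_,_] : B → Fin n → Formula B n
  ⋁ ⋀   : {K : Set k} → (K → Formula B n) → Formula B n

infixr 6 _⋁₂_
infixr 7 _⋀₂_

_⋁₂_ _⋀₂_ : ∀ {k} {B : Set k} {n} → Formula B n → Formula B n → Formula B n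
_⋁₂_ {k} φ ψ = ⋁ {K = Lift k Bool} λ i → if lower i then φ else ψ
_⋀₂_ {k} φ ψ = ⋀ {K = Lift k Bool} λ i → if lower i then φ else ψ

module _ {c ℓ₁ ℓ₂ k} {M : Lattice c ℓ₁ ℓ₂} (𝓑 : Basis M k) where
  open Lattice M
  open Basis 𝓑

  ⟦_⟧ : ∀ {n} → Formula Index n → Pred (Vector Carrier n) (ℓ₂ ⊔ k)
  ⟦ [ c , j ] ⟧   v = Lift k (elem c ≤ v j)
  ⟦ ⋁ {K = K} φ ⟧ v = Σ[ i ∈ K ] ⟦ φ i ⟧ v
  ⟦ ⋀ {K = K} φ ⟧ v = (i : K) → ⟦ φ i ⟧ v

  record IsSymbolic∃Move {n} (f : Vector Carrier n → Carrier)
                         (φ : Index → Formula Index n) : Set (c ⊔ ℓ₂ ⊔ k) where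
    field
      monotone : f Preserves Pointwise _≤_ ⟶ _≤_
      correct  : ∀ c → ⟦ φ c ⟧ ≐ (λ v → elem c ≤ f v)

module _ {a} {A : Set a} where

  unary : (A → A) → Vector A 1 → A
  unary f v = f (v zero)

  binary : (A → A → A) → Vector A 2 → A
  binary f v = f (v zero) (v (suc zero))

-- A finite lattice is required to be nonempty, i.e. to have a least element.
-- The greatest element then exists by finiteness.
record FiniteDistributiveLattice ℓ : Set (lsuc ℓ) where
  field
    distributiveLattice : DistributiveLattice ℓ ℓ ℓ
  open DistributiveLattice distributiveLattice public
    renaming (refl to ≤-refl; reflexive to ≤-reflexive; trans to ≤-trans)
  field
    ⊥           : Carrier
    minimum     : Minimum _≤_ ⊥
    size        : ℕ
    enumeration : Inverse (≡-setoid (Fin size)) setoid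

power : ∀ {ℓ} → Lattice ℓ ℓ ℓ → Set ℓ → Lattice ℓ ℓ ℓ
power L S = record
  { Carrier   = S → Carrier
  ; _≈_       = λ u v → ∀ x → u x ≈ v x
  ; _≤_       = λ u v → ∀ x → u x ≤ v x
  ; _∨_       = λ u v x → u x ∨ v x
  ; _∧_       = λ u v x → u x ∧ v x
  ; isLattice = record
    { isPartialOrder = record
      { isPreorder = record
        { isEquivalence = record
          { refl  = λ x → Eq.refl
          ; sym   = λ p x → Eq.sym (p x)
          ; trans = λ p q x → Eq.trans (p x) (q x)
          }
        ; reflexive = λ p x → reflexive (p x)
        ; trans     = λ p q x → trans (p x) (q x)
        }
      ; antisym = λ p q x → antisym (p x) (q x)
      }
    ; supremum = λ u v → (λ x → x≤x∨y (u x) (v x))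
                       , (λ x → y≤x∨y (u x) (v x))
                       , (λ w p q x → ∨-least (p x) (q x))
    ; infimum  = λ u v → (λ x → x∧y≤x (u x) (v x))
                       , (λ x → x∧y≤y (u x) (v x))
                       , (λ w p q x → ∧-greatest (p x) (q x))
    }
  }
  where open Lattice L

-- Classical logic is an explicit hypothesis: it is what makes a finite lattice
-- closed under joins of arbitrary subsets, and makes b at x below a total
-- function on an arbitrary set S.
module Complete {ℓ} (em : ExcludedMiddle (lsuc ℓ)) (L : FiniteDistributiveLattice ℓ) where
  open FiniteDistributiveLattice L

  em↓ : ExcludedMiddle ℓ
  em↓ {P} with em {Lift (lsuc ℓ) P}
  ... | yes (lift p) = yes p
  ... | no ¬p        = no λ p → ¬p (lift p)

  module E = Inverse enumeration

  enum-onto : ∀ l → E.to (E.from l) ≈ l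
  enum-onto = E.strictlyInverseˡ

  select : Pred Carrier ℓ → Carrier → Carrier
  select X l = if does (em↓ {∃[ l′ ] (X l′ × l ≈ l′)}) then l else ⊥

  join : ∀ {n} → Vector Carrier n → Carrier
  join = foldr _∨_ ⊥

  join-upper : ∀ {n} (v : Vector Carrier n) i → v i ≤ join v
  join-upper {suc n} v zero    = x≤x∨y _ _
  join-upper {suc n} v (suc i) = ≤-trans (join-upper (tail v) i) (y≤x∨y _ _)

  join-least : ∀ {n} (v : Vector Carrier n) {z} → (∀ i → v i ≤ z) → join v ≤ z
  join-least {zero}  v p = minimum _
  join-least {suc n} v p = ∨-least (p zero) (join-least (tail v) (λ i → p (suc i)))

  select-upper : ∀ X {l l′} → X l′ → l ≈ l′ → l ≤ select X l
  select-upper X {l} Xl′ l≈l′ with em↓ {∃[ l″ ] (X l″ × l ≈ l″)}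
  ... | yes _ = ≤-refl
  ... | no ¬p = contradiction (_ , Xl′ , l≈l′) ¬p

  select-least : ∀ X {l z} → (∀ {x} → X x → x ≤ z) → select X l ≤ z
  select-least X {l} ub with em↓ {∃[ l″ ] (X l″ × l ≈ l″)}
  ... | yes (_ , Xx , l≈x) = ≤-trans (≤-reflexive l≈x) (ub Xx)
  ... | no _               = minimum _

  ⨆ : Pred Carrier ℓ → Carrier
  ⨆ X = join (λ i → select X (E.to i))

  ⨆-isLub : ∀ X → IsLub _≤_ X (⨆ X)
  ⨆-isLub X =
      (λ {x} Xx → ≤-trans (≤-reflexive (Eq.sym (enum-onto x)))
                  (≤-trans (select-upper X Xx (enum-onto x))
                           (join-upper (λ i → select X (E.to i)) (E.from x))))
    , (λ ub → join-least (λ i → select X (E.to i)) (λ i → select-least X ub))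

  ⨅ : Pred Carrier ℓ → Carrier
  ⨅ X = ⨆ (λ l → ∀ x → X x → l ≤ x)

  ⨅-isGlb : ∀ X → IsGlb _≤_ X (⨅ X)
  ⨅-isGlb X = (λ Xx → proj₂ (⨆-isLub _) (λ lb → lb _ Xx))
            , (λ lb → proj₁ (⨆-isLub _) (λ _ → lb))

  image : {I : Set ℓ} → (I → Carrier) → Pred Carrier ℓ
  image f l = ∃[ i ] l ≈ f i

  infixr 5 _⇒_

  _⇒_ : Carrier → Carrier → Carrier
  l ⇒ m = ⨆ (λ l′ → l ∧ l′ ≤ m)

  -- Membership in X is up to the lattice's equality.
  JoinIrreducible : Carrier → Set (lsuc ℓ)
  JoinIrreducible b = (X : Pred Carrier ℓ) → b ≈ ⨆ X → ∃[ l ] (X l × b ≈ l)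

  B : Set (lsuc ℓ)
  B = Σ Carrier JoinIrreducible

  irreducibles-generate : ∀ {l z} → (∀ ((b , _) : B) → b ≤ l → b ≤ z) → l ≤ z
  irreducibles-generate {l} {z} below =
    ≤-trans (≤-reflexive (Eq.sym (enum-onto l)))
            (go (E.from l) (wf (E.from l))
                (λ b b≤ → below b (≤-trans b≤ (≤-reflexive (enum-onto l)))))
    where
    isPO = On.isPartialOrder E.to isPartialOrder
    _⊏_  = ToStrict._<_ (λ i j → E.to i ≈ E.to j) (λ i j → E.to i ≤ E.to j)
    wf   = FinInd.po-wellFounded isPO

    go : ∀ i → Acc _⊏_ i → (∀ ((b , _) : B) → b ≤ E.to i → b ≤ z) → E.to i ≤ z
    go i (acc rec) below with em {JoinIrreducible (E.to i)}
    ... | yes irr = below (_ , irr) ≤-refl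
    ... | no ¬irr = em⇒dne em↓ λ i≰z → ¬irr λ X i≈⨆X →
      em⇒dne em↓ λ i∉X → i≰z
        (≤-trans (≤-reflexive i≈⨆X) (proj₂ (⨆-isLub X) λ {x} Xx →
          let x≤i : x ≤ E.to i
              x≤i = ≤-trans (proj₁ (⨆-isLub X) Xx) (≤-reflexive (Eq.sym i≈⨆X))
              e≤x = ≤-reflexive (enum-onto x)
              x≤e = ≤-reflexive (Eq.sym (enum-onto x))
          in ≤-trans x≤e
               (go (E.from x)
                   (rec (≤-trans e≤x x≤i ,
                         λ e≈i → i∉X (x , Xx , Eq.trans (Eq.sym e≈i) (enum-onto x))))
                   (λ b b≤e → below b (≤-trans b≤e (≤-trans e≤x x≤i))))))

module FunctionLattice {ℓ} (em : ExcludedMiddle (lsuc ℓ))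
                       (L : FiniteDistributiveLattice ℓ) (S : Set ℓ) where
  open FiniteDistributiveLattice L
  open Complete em L

  Lˢ : Lattice ℓ ℓ ℓ
  Lˢ = power lattice S

  module Lˢ = Lattice Lˢ

  -- b at x is the function b_x.
  _at_ : Carrier → S → Lˢ.Carrier
  (b at x) y = if does (em↓ {y ≡ x}) then b else ⊥

  at-upper : ∀ b x → b ≤ (b at x) x
  at-upper b x with em↓ {x ≡ x}
  ... | yes _  = ≤-refl
  ... | no x≢x = contradiction refl x≢x

  at-least : ∀ {b x u} → b ≤ u x → (b at x) Lˢ.≤ u
  at-least {x = x} b≤ux y with em↓ {y ≡ x}
  ... | yes refl = b≤ux
  ... | no _     = minimum _

  basis : Basis Lˢ (lsuc ℓ)
  basis = record
    { Index     = B × S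
    ; elem      = λ ((b , _) , x) → b at x
    ; generates = λ u →
          (λ (_ , _ , m≤u) → m≤u)
        , (λ ub x → irreducibles-generate λ (b , irr) b≤ux →
            ≤-trans (at-upper b x)
                    (ub (((b , irr) , x) , Lˢ.Eq.refl {b at x} , at-least b≤ux) x))
    }

  Form : ℕ → Set (lsuc (lsuc ℓ))
  Form = Formula (B × S)

  _⇒ˢ_ : Lˢ.Carrier → Lˢ.Carrier → Lˢ.Carrier
  (u ⇒ˢ v) x = u x ⇒ v x

  ψ⊔ ψ⊓ : B × S → Form 2
  ψ⊔ c = [ c , zero ] ⋁₂ [ c , suc zero ]
  ψ⊓ c = [ c , zero ] ⋀₂ [ c , suc zero ]

  ψ⇒ : Carrier → B × S → Form 1
  ψ⇒ l ((b , _) , x) =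
    ⋀ {K = Σ[ (b′ , _) ∈ B ] (b′ ≤ l × b′ ≤ b)} λ (b′ , _) → [ (b′ , x) , zero ]

  module Modal (R : S → S → Carrier) where

    ◇ □ : Lˢ.Carrier → Lˢ.Carrier
    ◇ u x = ⨆ (image λ y → R x y ∧ u y)
    □ u x = ⨅ (image λ y → R x y ⇒ u y)

    ψ◇ ψ□ : B × S → Form 1
    ψ◇ (b , x) =
      ⋁ {K = Lift (lsuc ℓ) (Σ[ y ∈ S ] proj₁ b ≤ R x y)} λ (lift (y , _)) → [ (b , y) , zero ]
    ψ□ ((b , _) , x) =
      ⋀ {K = Σ[ y ∈ S ] Σ[ (b′ , _) ∈ B ] (b′ ≤ R x y × b′ ≤ b)} λ (y , b′ , _) → [ (b′ , y) , zero ]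

{-# OPTIONS --safe #-}

-- In a finite distributive lattice binary meet distributes over arbitrary
-- joins.  Hence join-irreducible elements are completely join-prime, which gives
-- the disjunctive moves, and l ∧ b ≤ m ⇔ b ≤ (l ⇒ m), which gives the
-- conjunctive ones once l ∧ b is replaced by the irreducibles below it.
module Submission where

open import Defs
open import Axiom.ExcludedMiddle using (ExcludedMiddle)
open import Data.Bool.Base using (true; false)
open import Data.Fin.Base using (zero; suc)
open import Data.Nat.Base using (zero; suc)
open import Data.Product.Base using (_×_; _,_; proj₁; proj₂; ∃-syntax)
open import Data.Vec.Functional using (Vector; tail)
open import Data.Vec.Functional.Relation.Binary.Pointwise using (Pointwise)
open import Data.Sum.Base using (_⊎_; inj₁; inj₂)
open import Function.Base using (const; case_of_)
open import Level using (Level; lift; lower) renaming (suc to lsuc)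
open import Relation.Binary.Lattice.Bundles using (Lattice)
open import Relation.Nullary using (yes; no)
open import Relation.Unary using (Pred; _≐_)

module _ {c ℓ₁ ℓ₂ k} {M : Lattice c ℓ₁ ℓ₂} (𝓑 : Basis M k) where
  open Lattice M
  open Basis 𝓑

  ⟦⟧-mono : ∀ {n} (φ : Formula Index n) {v w} →
            Pointwise _≤_ v w → ⟦_⟧ 𝓑 φ v → ⟦_⟧ 𝓑 φ w
  ⟦⟧-mono [ c , j ] v≤w (lift c≤) = lift (trans c≤ (v≤w j))
  ⟦⟧-mono (⋁ φ)     v≤w (i , p)   = i , ⟦⟧-mono (φ i) v≤w p
  ⟦⟧-mono (⋀ φ)     v≤w p i       = ⟦⟧-mono (φ i) v≤w (p i)

  -- Formulae denote upward closed sets, so a function that they describe on a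
  -- basis is automatically monotone.
  correct⇒move : ∀ {n} {f : Vector Carrier n → Carrier} {φ : Index → Formula Index n} →
                 (∀ c → ⟦_⟧ 𝓑 (φ c) ≐ (λ v → elem c ≤ f v)) → IsSymbolic∃Move 𝓑 f φ
  correct⇒move {f = f} {φ} correct = record
    { monotone = λ {v} {w} v≤w → proj₂ (generates (f v)) λ (c , m≈c , m≤fv) →
        trans (reflexive m≈c)
              (proj₁ (correct c)
                (⟦⟧-mono (φ c) v≤w
                  (proj₂ (correct c) (trans (reflexive (Eq.sym m≈c)) m≤fv))))
    ; correct  = correct
    }

module _ {ℓ} (em : ExcludedMiddle (lsuc ℓ)) (L : FiniteDistributiveLattice ℓ) where
  open FiniteDistributiveLattice L
  open Complete em L

  -- Distributivity enters here: induction on the vector extends the binary law to finite joins,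
  -- with `⊥` covering the empty one.
  ∧-join-least : ∀ {n} (v : Vector Carrier n) {l z} →
                 (∀ i → l ∧ v i ≤ z) → l ∧ join v ≤ z
  ∧-join-least {zero}  v p = ≤-trans (x∧y≤y _ _) (minimum _)
  ∧-join-least {suc n} v p =
    ≤-trans (≤-reflexive (∧-distribˡ-∨ _ _ _))
            (∨-least (p zero) (∧-join-least (tail v) (λ i → p (suc i))))

  ∧-select-least : ∀ X {l m z} → (∀ {x} → X x → l ∧ x ≤ z) → l ∧ select X m ≤ z
  ∧-select-least X {l} {m} p with em↓ {∃[ x ] (X x × m ≈ x)}
  -- An element outside `X` is replaced by `⊥`, whose meet with `l` lies below everything.
  ... | no _               = ≤-trans (x∧y≤y _ _) (minimum _)
  ... | yes (_ , Xx , m≈x) =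
    ≤-trans (∧-greatest (x∧y≤x _ _) (≤-trans (x∧y≤y _ _) (≤-reflexive m≈x))) (p Xx)

  ∧-⨆-least : ∀ X {l z} → (∀ {x} → X x → l ∧ x ≤ z) → l ∧ ⨆ X ≤ z
  ∧-⨆-least X p = ∧-join-least (λ i → select X (E.to i)) (λ i → ∧-select-least X p)

  ⇒-intro : ∀ {l m b} → l ∧ b ≤ m → b ≤ (l ⇒ m)
  ⇒-intro = proj₁ (⨆-isLub _)

  -- Meeting with `l` passes through the join that defines `l ⇒ m`, so this join satisfies its own
  -- defining condition.
  ⇒-elim : ∀ {l m b} → b ≤ (l ⇒ m) → l ∧ b ≤ m
  ⇒-elim b≤l⇒m =
    ≤-trans (∧-greatest (x∧y≤x _ _) (≤-trans (x∧y≤y _ _) b≤l⇒m)) (∧-⨆-least _ λ p → p)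

  -- The two bounds on `b′` together say `b′ ≤ l ∧ b`, and the irreducibles below `l ∧ b` suffice to
  -- test `l ∧ b ≤ m`.
  ⇒-intro-irreducible : ∀ {l m b} →
    (∀ ((b′ , _) : B) → b′ ≤ l → b′ ≤ b → b′ ≤ m) → b ≤ (l ⇒ m)
  ⇒-intro-irreducible p = ⇒-intro (irreducibles-generate λ b′ b′≤l∧b →
    p b′ (≤-trans b′≤l∧b (x∧y≤x _ _)) (≤-trans b′≤l∧b (x∧y≤y _ _)))

  ⇒-elim-≤ : ∀ {l m b b′} → b ≤ (l ⇒ m) → b′ ≤ l → b′ ≤ b → b′ ≤ m
  ⇒-elim-≤ b≤l⇒m b′≤l b′≤b = ≤-trans (∧-greatest b′≤l b′≤b) (⇒-elim b≤l⇒m)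

  -- Meeting every member of `X` with `b` gives a family `Y` whose join is exactly `b`.
  -- Irreducibility then yields `b ≈ b ∧ x` for some `x` in `X`, hence `b ≤ x`.
  irreducible⇒prime : ∀ {b} → JoinIrreducible b → ∀ X → b ≤ ⨆ X → ∃[ x ] (X x × b ≤ x)
  irreducible⇒prime {b} irr X b≤⨆X
    with irr Y (antisym b≤⨆Y (proj₂ (⨆-isLub Y) λ (_ , _ , y≈) →
                                ≤-trans (≤-reflexive y≈) (x∧y≤x _ _)))
    where
    Y : Pred Carrier _
    Y y = ∃[ x ] (X x × y ≈ b ∧ x)

    b≤⨆Y : b ≤ ⨆ Y
    b≤⨆Y = ≤-trans (∧-greatest ≤-refl b≤⨆X)
                   (∧-⨆-least X λ Xx → proj₁ (⨆-isLub Y) (_ , Xx , Eq.refl))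
  ... | _ , (x , Xx , y≈) , b≈y =
    x , Xx , ≤-trans (≤-reflexive (Eq.trans b≈y y≈)) (x∧y≤y _ _)

  -- Complete primeness applied to the subset `Pair`, whose join lies above `u ∨ v`.
  irreducible⇒∨-prime : ∀ {b} → JoinIrreducible b → ∀ u v → b ≤ u ∨ v → b ≤ u ⊎ b ≤ v
  irreducible⇒∨-prime {b} irr u v b≤u∨v = split (irreducible⇒prime irr Pair
    (≤-trans b≤u∨v (∨-least (proj₁ (⨆-isLub Pair) (inj₁ Eq.refl))
                            (proj₁ (⨆-isLub Pair) (inj₂ Eq.refl)))))
    where
    Pair : Pred Carrier _
    Pair l = l ≈ u ⊎ l ≈ v

    split : ∃[ l ] (Pair l × b ≤ l) → b ≤ u ⊎ b ≤ v
    split (_ , inj₁ l≈u , b≤l) = inj₁ (≤-trans b≤l (≤-reflexive l≈u))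
    split (_ , inj₂ l≈v , b≤l) = inj₂ (≤-trans b≤l (≤-reflexive l≈v))

  module _ (S : Set ℓ) where
    open FunctionLattice em L S

    -- Together with `at-least`, this turns inequalities between functions with `b at x` on the left
    -- into inequalities in `L`.
    at-least⁻¹ : ∀ {b x u} → (b at x) Lˢ.≤ u → b ≤ u x
    at-least⁻¹ {b} {x} bₓ≤u = ≤-trans (at-upper b x) (bₓ≤u x)

    ⊔-move : IsSymbolic∃Move basis (binary Lˢ._∨_) ψ⊔
    ⊔-move = correct⇒move basis λ ((b , irr) , x) →
        (λ { {v} (lift true  , lift p) → at-least (≤-trans (at-least⁻¹ p) (x≤x∨y _ _))
           ; {v} (lift false , lift p) → at-least (≤-trans (at-least⁻¹ p) (y≤x∨y _ _)) })
      , (λ {v} p → case irreducible⇒∨-prime irr (v zero x) (v (suc zero) x) (at-least⁻¹ p) of λ where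
           (inj₁ q) → lift true  , lift (at-least q)
           (inj₂ q) → lift false , lift (at-least q))

    ⊓-move : IsSymbolic∃Move basis (binary Lˢ._∧_) ψ⊓
    ⊓-move = correct⇒move basis λ c →
        (λ p → Lˢ.∧-greatest (lower (p (lift true))) (lower (p (lift false))))
      , (λ { {v} p (lift true)  → lift (Lˢ.trans p (Lˢ.x∧y≤x (v zero) (v (suc zero))))
           ; {v} p (lift false) → lift (Lˢ.trans p (Lˢ.x∧y≤y (v zero) (v (suc zero)))) })

    ⇒-move : ∀ l → IsSymbolic∃Move basis (unary (const l ⇒ˢ_)) (ψ⇒ l)
    ⇒-move l = correct⇒move basis λ _ →
        (λ p → at-least (⇒-intro-irreducible λ b′ b′≤l b′≤b →
           at-least⁻¹ (lower (p (b′ , b′≤l , b′≤b)))))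
      , (λ { p (_ , b′≤l , b′≤b) → lift (at-least (⇒-elim-≤ (at-least⁻¹ p) b′≤l b′≤b)) })

    module _ (R : S → S → Carrier) where
      open Modal R

      ◇-move : IsSymbolic∃Move basis (unary ◇) ψ◇
      ◇-move = correct⇒move basis λ ((b , irr) , x) →
          (λ { (lift (y , b≤R) , lift p) → at-least
             (≤-trans (∧-greatest b≤R (at-least⁻¹ p)) (proj₁ (⨆-isLub _) (y , Eq.refl))) })
        -- Primeness picks one state `y` with `b ≤ R x y ∧ u y`, where `u` is the argument: the
        -- first factor makes `y` an admissible index, the second gives the atom at `y`.
        , (λ p → case irreducible⇒prime irr _ (at-least⁻¹ p) of λ
             { (_ , (y , l≈) , b≤l) →
               let b≤∧ = ≤-trans b≤l (≤-reflexive l≈)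
               in  lift (y , ≤-trans b≤∧ (x∧y≤x _ _))
                 , lift (at-least (≤-trans b≤∧ (x∧y≤y _ _))) })

      □-move : IsSymbolic∃Move basis (unary □) ψ□
      □-move = correct⇒move basis λ _ →
          -- It is enough to bound `b` by each `R x y ⇒ u y` separately, which is the argument for
          -- implication with `R x y` as premise and atoms taken at `y`.
          (λ p → at-least (proj₂ (⨅-isGlb _) λ { (y , l≈) →
             ≤-trans (⇒-intro-irreducible λ b′ b′≤R b′≤b →
                       at-least⁻¹ (lower (p (y , b′ , b′≤R , b′≤b))))
                     (≤-reflexive (Eq.sym l≈)) }))
        , (λ { p (y , _ , b′≤R , b′≤b) → lift (at-least (⇒-elim-≤
             (≤-trans (at-least⁻¹ p) (proj₁ (⨅-isGlb _) (y , Eq.refl))) b′≤R b′≤b)) })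

proposition6p3 :
  {ℓ : Level} (em : ExcludedMiddle (lsuc ℓ))
  (L : FiniteDistributiveLattice ℓ) (S : Set ℓ)
  (R : S → S → FiniteDistributiveLattice.Carrier L) →
  let open FunctionLattice em L S
      open Modal R
  in  IsSymbolic∃Move basis (binary Lˢ._∨_) ψ⊔
    × IsSymbolic∃Move basis (binary Lˢ._∧_) ψ⊓
    × (∀ l → IsSymbolic∃Move basis (unary (const l ⇒ˢ_)) (ψ⇒ l))
    × IsSymbolic∃Move basis (unary ◇) ψ◇
    × IsSymbolic∃Move basis (unary □) ψ□
proposition6p3 em L S R =
  ⊔-move em L S , ⊓-move em L S , ⇒-move em L S , ◇-move em L S R , □-move em L S R
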